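{- For all integers $r \ge 2$ and $d \in \mathbb{N}$ there exists a real number $\alpha_{r,d} \ge (5rd)^{1-r}$ with the following property: for every $d$-trace-bounded $r$-partite $r$-graph $H$ there exists $n_0(H)$ such that for every $n \ge n_0(H)$, every $r$-graph on $n$ vertices with at least $n^{r-\alpha_{r,d}}$ edges contains a copy of $H$ (a subgraph isomorphic to $H$).
   Context: An $r$-graph $G$ on a vertex set $V$ is a family of $r$-element subsets of $V$ (its edges). It is $r$-partite with partition classes $V_1, \dots, V_r$ (a partition of its vertex set) if every edge contains exactly one vertex from each $V_i$. The trace of $G$ on $U \subseteq V$ is the family $\{S \cap U : S \in E(G)\}$; for an $r$-partite $r$-graph with partition classes $V_1,\dots,V_r$, $\mathrm{Tr}_i(G)$ denotes the trace of $G$ on $V_1 \cup \dots \cup V_i$, an $i$-graph. The degree of a vertex $v$ in a hypergraph is the number of edges containing $v$. An $r$-partite $r$-graph $H$ with partition classes $V_1, V_2, \dots, V_r$ is $d$-trace-bounded if for each $2 \le i \le r$, every vertex of $V_i$ has degree at most $d$ in $\mathrm{Tr}_i(H)$. -}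

module Defs where

open import Data.Nat using (ℕ; _≤_; _^_; _*_)
open import Data.Bool using (Bool; true; false; _≟_)
open import Data.Fin using (Fin; toℕ)
open import Data.Fin.Subset using (Subset; _∈_; _∩_; ∣_∣; inside; outside)
open import Data.Fin.Subset.Properties using (_∈?_)
open import Data.Vec using (tabulate)
open import Data.Vec.Properties using (≡-dec)
open import Data.List using (List; length; filter; map; deduplicate)
open import Data.List.Relation.Unary.All using (All)
open import Data.List.Relation.Unary.Unique.Propositional using (Unique)
open import Data.List.Membership.Propositional renaming (_∈_ to _∈ₗ_)
open import Data.Product using (Σ; ∃; _×_; ∃!)
open import Relation.Binary.PropositionalEquality using (_≡_)
open import Relation.Nullary using (¬_)
open import Relation.Nullary.Decidable using (Dec; yes; no)
open import Data.Nat.Properties using (_≤?_)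
open import Function using (_⇔_)
open import Function.Definitions using (Injective)

record RGraph (r n : ℕ) : Set where
  field
    edges    : List (Subset n)
    distinct : Unique edges
    uniform  : All (λ S → ∣ S ∣ ≡ r) edges
open RGraph public

numEdges : ∀ {r n} → RGraph r n → ℕ
numEdges G = length (edges G)

-- An r-partite r-graph on the vertex set Fin m with partition classes
-- V_i = part ⁻¹ (i) (class index 0..r-1 corresponds to V_1..V_r).
-- Every edge contains exactly one vertex of each class.
record PartiteGraph (r m : ℕ) : Set where
  field
    part      : Fin m → Fin r
    pedges    : List (Subset m)
    pdistinct : Unique pedges
    transversal : All (λ S → (i : Fin r) → ∃! _≡_ (λ v → v ∈ S × part v ≡ i)) pedges
open PartiteGraph public

-- The vertex set V_1 ∪ … ∪ V_{i+1} (classes with index ≤ i, 0-indexed).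
lowerUnion : ∀ {r m} → PartiteGraph r m → Fin r → Subset m
lowerUnion H i = tabulate (λ v → decide (toℕ (part H v) ≤? toℕ i))
  where
  decide : ∀ {P : Set} → Dec P → Bool
  decide (yes _) = true
  decide (no _)  = false

traceEdges : ∀ {r m} → PartiteGraph r m → Fin r → List (Subset m)
traceEdges H i = deduplicate (≡-dec _≟_) (map (λ S → S ∩ lowerUnion H i) (pedges H))

traceDegree : ∀ {r m} → PartiteGraph r m → Fin r → Fin m → ℕ
traceDegree H i v = length (filter (λ T → v ∈? T) (traceEdges H i))

-- d-trace-bounded: for each class V_i with 2 ≤ i ≤ r (0-indexed: toℕ i ≥ 1),
-- every vertex of V_i has degree at most d in Tr_i(H).
TraceBounded : ∀ {r m} → ℕ → PartiteGraph r m → Set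
TraceBounded {r} {m} d H =
  (i : Fin r) → 1 ≤ toℕ i → (v : Fin m) → part H v ≡ i → traceDegree H i v ≤ d

ContainsCopy : ∀ {r m n} → RGraph r n → PartiteGraph r m → Set
ContainsCopy {r} {m} {n} G H =
  Σ (Fin m → Fin n) λ φ → Injective _≡_ _≡_ φ ×
    All (λ S → ∃ λ T → T ∈ₗ edges G ×
           ((w : Fin n) → (w ∈ T ⇔ ∃ λ v → v ∈ S × φ v ≡ w))) (pedges H)

{-# OPTIONS --safe #-}
-- View the edges of G as a set E of at least n^r / a ordered r-tuples, where a is about n^(1/q).
-- Dependent random choice removes the last class: for t = rd random vertices, let E′ be the set of
-- (r-1)-tuples joined by E to all of them. By convexity E′ has on average at least n^(r-1) / a^t
-- tuples, while the expected number of d-tuples of elements of E′ with at most m common neighbours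
-- is at most n^((r-1)d) (m/n)^t, which is tiny. So some choice leaves no such d-tuple and still has
-- |E′| ≥ n^(r-1) / a^(t+1). By induction Tr_{r-1}(H) embeds in E′; every vertex of the last class has
-- at most d traces below it, whose images have more than m common neighbours, so it can be placed
-- on a new vertex. After r-1 rounds a has grown to the power (rd+1)^(r-1), which (5rd)^(r-1) beats.
module Submission where

open import Defs
open import Data.Nat using (ℕ; zero; suc; _+_; _*_; _^_; _∸_; _≤_; _<_; _≤ᵇ_; z≤n; s≤s; NonZero; >-nonZero)
open import Data.Nat.Properties
open import Data.Nat.Tactic.RingSolver using (solve-∀)
open import Data.Nat.ListAction using (sum)
open import Data.Nat.ListAction.Properties using (sum-++)
open import Data.Bool as Bool using (Bool; true; false; T; _∧_; _∨_)
open import Data.Bool.ListAction using (all)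
open import Data.Bool.Properties using (∧-comm)
open import Data.Fin using (Fin; zero; suc; toℕ; fromℕ<; inject≤)
open import Data.Fin.Properties as FinP using (inject≤-injective)
open import Data.Fin.Subset using (Subset; _∈_; _⊆_; _∩_; ∣_∣)
open import Data.Fin.Subset.Properties using (_∈?_; ⊆-antisym; p∩q⊆p; x∈p∩q⁺)
open import Data.Vec using ([]; _∷_; here; there; lookup)
open import Data.Vec.Properties using (≡-dec; lookup⇒[]=; lookup∘tabulate)
open import Data.Vec.Functional using (updateAt)
open import Data.Vec.Functional.Properties using (updateAt-updates; updateAt-minimal)
open import Data.List using (List; []; _∷_; _++_; map; length; filter; replicate; allFin; cartesianProductWith)
open import Data.List.Properties using (map-++; map-∘; map-cong-local; length-map; length-++; length-replicate; length-filter; length-tabulate) renaming (≡-dec to List-≡-dec)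
open import Data.List.Membership.Propositional using (find; lose) renaming (_∈_ to _∈ₗ_; _∉_ to _∉ₗ_)
open import Data.List.Membership.Propositional.Properties using (∈-map⁺; ∈-map⁻; ∈-allFin; ∈-filter⁺; ∈-++⁺ˡ; ∈-deduplicate⁺; ∈-cartesianProductWith⁺)
import Data.List.Membership.DecPropositional as DecMembership
open import Data.List.Relation.Unary.Any using (here; there; any?)
open import Data.List.Relation.Unary.All as All using (All; []; _∷_)
open import Data.List.Relation.Unary.All.Properties as AllP using (All¬⇒¬Any)
open import Data.List.Relation.Unary.AllPairs using ([]; _∷_)
open import Data.List.Relation.Unary.Unique.Propositional using (Unique)
open import Data.List.Relation.Unary.Unique.Propositional.Properties as UniqueP using (allFin⁺)
open import Data.Product using (Σ; ∃; _×_; _,_; proj₁; proj₂)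
open import Data.Sum using (inj₁; inj₂)
open import Function using (_∋_; _⇔_; mk⇔; Equivalence)
open import Function.Definitions using (Injective)
open import Relation.Nullary using (yes; no; does; contradiction)
open import Relation.Nullary.Decidable using (dec-true; dec-false; _×-dec_)
open import Relation.Binary.Definitions using (DecidableEquality)
open import Relation.Binary.PropositionalEquality using (_≡_; _≢_; refl; sym; trans; cong; cong₂; subst; subst₂)

private
  variable
    A B : Set

-- Powers of natural numbers.

^-distribʳ-* : ∀ k x y → (x * y) ^ k ≡ x ^ k * y ^ k
^-distribʳ-* zero    x y = refl
^-distribʳ-* (suc k) x y = trans (cong (x * y *_) (^-distribʳ-* k x y)) (interchange x y (x ^ k) (y ^ k))
  where
  interchange : ∀ x y u v → x * y * (u * v) ≡ x * u * (y * v)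
  interchange = solve-∀

m≤m^1+n : ∀ m n → m ≤ m ^ suc n
m≤m^1+n zero      n = z≤n
m≤m^1+n m@(suc _) n = m≤m*n m (m ^ n) {{m^n≢0 m n}}

-- Finite sums

∑ : List A → (A → ℕ) → ℕ
∑ xs f = sum (map f xs)

⟦_⟧ : Bool → ℕ
⟦ false ⟧ = 0
⟦ true  ⟧ = 1

⟦⟧≤1 : ∀ b → ⟦ b ⟧ ≤ 1
⟦⟧≤1 false = z≤n
⟦⟧≤1 true  = ≤-refl

⟦⟧-∧ : ∀ a b → ⟦ a ∧ b ⟧ ≡ ⟦ a ⟧ * ⟦ b ⟧
⟦⟧-∧ false b = refl
⟦⟧-∧ true  b = sym (+-identityʳ ⟦ b ⟧)

∑-cong : ∀ (xs : List A) {f g} → (∀ x → f x ≡ g x) → ∑ xs f ≡ ∑ xs g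
∑-cong []       f≡g = refl
∑-cong (x ∷ xs) f≡g = cong₂ _+_ (f≡g x) (∑-cong xs f≡g)

∑-mono : ∀ (xs : List A) {f g} → (∀ x → f x ≤ g x) → ∑ xs f ≤ ∑ xs g
∑-mono []       f≤g = z≤n
∑-mono (x ∷ xs) f≤g = +-mono-≤ (f≤g x) (∑-mono xs f≤g)

∑-const : ∀ (xs : List A) c → ∑ xs (λ _ → c) ≡ length xs * c
∑-const []       c = refl
∑-const (x ∷ xs) c = cong (c +_) (∑-const xs c)

∑-1 : ∀ (xs : List A) → ∑ xs (λ _ → 1) ≡ length xs
∑-1 xs = trans (∑-const xs 1) (*-identityʳ (length xs))

∑-+ : ∀ (xs : List A) f g → ∑ xs (λ x → f x + g x) ≡ ∑ xs f + ∑ xs g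
∑-+ []       f g = refl
∑-+ (x ∷ xs) f g = trans (cong (f x + g x +_) (∑-+ xs f g)) (interchange (f x) (g x) (∑ xs f) (∑ xs g))
  where
  interchange : ∀ a b c e → a + b + (c + e) ≡ a + c + (b + e)
  interchange = solve-∀

∑-*ˡ : ∀ (xs : List A) c f → ∑ xs (λ x → c * f x) ≡ c * ∑ xs f
∑-*ˡ []       c f = sym (*-zeroʳ c)
∑-*ˡ (x ∷ xs) c f = trans (cong (c * f x +_) (∑-*ˡ xs c f)) (sym (*-distribˡ-+ c (f x) (∑ xs f)))

∑-*ʳ : ∀ (xs : List A) f c → ∑ xs (λ x → f x * c) ≡ ∑ xs f * c
∑-*ʳ xs f c = trans (∑-cong xs (λ x → *-comm (f x) c)) (trans (∑-*ˡ xs c f) (*-comm c (∑ xs f)))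

∑-swap : ∀ (xs : List A) (ys : List B) (f : A → B → ℕ) →
         ∑ xs (λ x → ∑ ys (f x)) ≡ ∑ ys (λ y → ∑ xs (λ x → f x y))
∑-swap []       ys f = sym (trans (∑-const ys 0) (*-zeroʳ (length ys)))
∑-swap (x ∷ xs) ys f = trans (cong (∑ ys (f x) +_) (∑-swap xs ys f)) (sym (∑-+ ys (f x) _))

∑-member : ∀ {xs : List A} {x} (f : A → ℕ) → x ∈ₗ xs → f x ≤ ∑ xs f
∑-member f (here refl)          = m≤m+n _ _
∑-member f (there {x = y} x∈xs) = ≤-trans (∑-member f x∈xs) (m≤n+m _ (f y))

-- Plays the role of the expectation argument: it extracts one sample from an inequality between
-- sums over all samples.
∑-<⇒∃-< : ∀ (xs : List A) {f g} → ∑ xs f < ∑ xs g → ∃ λ x → f x < g x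
∑-<⇒∃-< (x ∷ xs) {f} {g} lt with <-≤-connex (f x) (g x)
... | inj₁ fx<gx = x , fx<gx
... | inj₂ gx≤fx = ∑-<⇒∃-< xs (≰⇒> λ ge → <⇒≱ lt (+-mono-≤ gx≤fx ge))

-- Convexity: from Chebyshev's sum inequality to power means.

rearrangement : ∀ {a b p q} → a ≤ b → p ≤ q → a * q + b * p ≤ a * p + b * q
rearrangement {a} {b} {p} {q} a≤b p≤q
  rewrite sym (m+[n∸m]≡n a≤b) | sym (m+[n∸m]≡n p≤q) =
  -- With `b = a + k` and `q = p + l` the two sides differ by exactly `k * l`.
  ≤-trans (m≤m+n _ ((b ∸ a) * (q ∸ p))) (≤-reflexive (expand a p (b ∸ a) (q ∸ p)))
  where
  expand : ∀ a p k l → a * (p + l) + (a + k) * p + k * l ≡ a * p + (a + k) * (p + l)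
  expand = solve-∀

-- The hypothesis says pairwise that `f` and `g` are similarly ordered. Adding an entry `x` creates
-- the cross terms `f x * g y + f y * g x`, which it bounds one `y` at a time.
chebyshev-sum : ∀ (xs : List A) f g → (∀ x y → f x * g y + f y * g x ≤ f x * g x + f y * g y) →
                ∑ xs f * ∑ xs g ≤ length xs * ∑ xs (λ x → f x * g x)
chebyshev-sum []       f g sorted = z≤n
chebyshev-sum (x ∷ xs) f g sorted = begin
  (f x + F) * (g x + G)                         ≡⟨ expand (f x) (g x) F G ⟩
  f x * g x + (f x * G + F * g x) + F * G       ≤⟨ +-mono-≤ (+-monoʳ-≤ (f x * g x) cross) (chebyshev-sum xs f g sorted) ⟩
  f x * g x + (l * (f x * g x) + FG) + l * FG   ≡⟨ collect (f x * g x) FG l ⟩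
  suc l * (f x * g x + FG)                      ∎
  where
  open ≤-Reasoning
  F  = ∑ xs f
  G  = ∑ xs g
  FG = ∑ xs (λ y → f y * g y)
  l  = length xs
  expand : ∀ a b F G → (a + F) * (b + G) ≡ a * b + (a * G + F * b) + F * G
  expand = solve-∀
  collect : ∀ p S l → p + (l * p + S) + l * S ≡ suc l * (p + S)
  collect = solve-∀
  cross : f x * G + F * g x ≤ l * (f x * g x) + FG
  cross = begin
    f x * G + F * g x                                ≡⟨ cong₂ _+_ (∑-*ˡ xs (f x) g) (∑-*ʳ xs f (g x)) ⟨
    ∑ xs (λ y → f x * g y) + ∑ xs (λ y → f y * g x)  ≡⟨ ∑-+ xs _ _ ⟨
    ∑ xs (λ y → f x * g y + f y * g x)               ≤⟨ ∑-mono xs (sorted x) ⟩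
    ∑ xs (λ y → f x * g x + f y * g y)               ≡⟨ ∑-+ xs _ _ ⟩
    ∑ xs (λ _ → f x * g x) + FG                      ≡⟨ cong (_+ FG) (∑-const xs _) ⟩
    l * (f x * g x) + FG                             ∎

-- Jensen's inequality for the power `suc t`, cleared of denominators. In the induction on `t`,
-- Chebyshev applies to `f` and its power because the two are ordered alike.
power-mean : ∀ (xs : List A) f t → ∑ xs f ^ suc t ≤ length xs ^ t * ∑ xs (λ x → f x ^ suc t)
power-mean xs f zero = ≤-reflexive (begin-equality
  ∑ xs f * 1                  ≡⟨ ∑-*ʳ xs f 1 ⟨
  ∑ xs (λ x → f x * 1)        ≡⟨ *-identityˡ _ ⟨
  1 * ∑ xs (λ x → f x * 1)    ∎)
  where open ≤-Reasoning
power-mean xs f (suc t) = begin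
  ∑ xs f * ∑ xs f ^ suc t                                     ≤⟨ *-monoʳ-≤ (∑ xs f) (power-mean xs f t) ⟩
  ∑ xs f * (length xs ^ t * S)                                ≡⟨ pull (∑ xs f) (length xs ^ t) S ⟩
  length xs ^ t * (∑ xs f * S)                                ≤⟨ *-monoʳ-≤ (length xs ^ t) (chebyshev-sum xs f (λ x → f x ^ suc t) sorted) ⟩
  length xs ^ t * (length xs * ∑ xs (λ x → f x ^ suc (suc t))) ≡⟨ regroup (length xs) (length xs ^ t) _ ⟩
  length xs ^ suc t * ∑ xs (λ x → f x ^ suc (suc t))          ∎
  where
  open ≤-Reasoning
  S = ∑ xs (λ x → f x ^ suc t)
  pull : ∀ a b c → a * (b * c) ≡ b * (a * c)
  pull = solve-∀
  regroup : ∀ l p s → p * (l * s) ≡ l * p * s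
  regroup = solve-∀
  swap-sides : ∀ a b p q → b * p + a * q ≤ b * q + a * p → a * q + b * p ≤ a * p + b * q
  swap-sides a b p q = subst₂ _≤_ (+-comm (b * p) (a * q)) (+-comm (b * q) (a * p))
  sorted : ∀ x y → f x * f y ^ suc t + f y * f x ^ suc t ≤ f x * f x ^ suc t + f y * f y ^ suc t
  sorted x y with ≤-total (f x) (f y)
  ... | inj₁ x≤y = rearrangement x≤y (^-monoˡ-≤ (suc t) x≤y)
  ... | inj₂ y≤x = swap-sides (f x) (f y) (f x ^ suc t) (f y ^ suc t) (rearrangement y≤x (^-monoˡ-≤ (suc t) y≤x))

-- Tuples

tuples : ℕ → List A → List (List A)
tuples zero    xs = [] ∷ []
tuples (suc t) xs = cartesianProductWith _∷_ xs (tuples t xs)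

∈-tuples : ∀ {xs : List A} {v} → All (_∈ₗ xs) v → v ∈ₗ tuples (length v) xs
∈-tuples []            = here refl
∈-tuples (x∈xs ∷ v⊆xs) = ∈-cartesianProductWith⁺ _∷_ x∈xs (∈-tuples v⊆xs)

∑-tuples : ∀ t (xs : List A) f → ∑ (tuples (suc t) xs) f ≡ ∑ xs (λ x → ∑ (tuples t xs) (λ v → f (x ∷ v)))
∑-tuples t xs f = go xs
  where
  vs = tuples t xs
  go : ∀ zs → ∑ (cartesianProductWith _∷_ zs vs) f ≡ ∑ zs (λ x → ∑ vs (λ v → f (x ∷ v)))
  go []       = refl
  go (z ∷ zs) = begin-equality
    sum (map f (map (z ∷_) vs ++ cartesianProductWith _∷_ zs vs))
      ≡⟨ cong sum (map-++ f (map (z ∷_) vs) _) ⟩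
    sum (map f (map (z ∷_) vs) ++ map f (cartesianProductWith _∷_ zs vs))
      ≡⟨ sum-++ (map f (map (z ∷_) vs)) _ ⟩
    sum (map f (map (z ∷_) vs)) + ∑ (cartesianProductWith _∷_ zs vs) f
      ≡⟨ cong₂ _+_ (cong sum (sym (map-∘ vs))) (go zs) ⟩
    ∑ vs (λ v → f (z ∷ v)) + ∑ zs (λ x → ∑ vs (λ v → f (x ∷ v))) ∎
    where open ≤-Reasoning

length-tuples : ∀ t (xs : List A) → length (tuples t xs) ≡ length xs ^ t
length-tuples zero    xs = refl
length-tuples (suc t) xs = begin-equality
  length (tuples (suc t) xs)              ≡⟨ ∑-1 (tuples (suc t) xs) ⟨
  ∑ (tuples (suc t) xs) (λ _ → 1)         ≡⟨ ∑-tuples t xs _ ⟩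
  ∑ xs (λ _ → ∑ (tuples t xs) (λ _ → 1))  ≡⟨ ∑-const xs _ ⟩
  length xs * ∑ (tuples t xs) (λ _ → 1)   ≡⟨ cong (length xs *_) (trans (∑-1 (tuples t xs)) (length-tuples t xs)) ⟩
  length xs * length xs ^ t               ∎
  where open ≤-Reasoning

∑-tuples-all : ∀ t (xs : List A) (p : A → Bool) →
               ∑ (tuples t xs) (λ v → ⟦ all p v ⟧) ≡ ∑ xs (λ x → ⟦ p x ⟧) ^ t
∑-tuples-all zero    xs p = refl
∑-tuples-all (suc t) xs p = begin-equality
  ∑ (tuples (suc t) xs) (λ v → ⟦ all p v ⟧)                        ≡⟨ ∑-tuples t xs _ ⟩
  ∑ xs (λ x → ∑ (tuples t xs) (λ v → ⟦ p x ∧ all p v ⟧))           ≡⟨ ∑-cong xs factor ⟩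
  ∑ xs (λ x → ⟦ p x ⟧ * ∑ xs (λ y → ⟦ p y ⟧) ^ t)                  ≡⟨ ∑-*ʳ xs _ _ ⟩
  ∑ xs (λ x → ⟦ p x ⟧) * ∑ xs (λ x → ⟦ p x ⟧) ^ t                  ∎
  where
  open ≤-Reasoning
  factor : ∀ x → ∑ (tuples t xs) (λ v → ⟦ p x ∧ all p v ⟧) ≡ ⟦ p x ⟧ * ∑ xs (λ y → ⟦ p y ⟧) ^ t
  factor x = begin-equality
    ∑ (tuples t xs) (λ v → ⟦ p x ∧ all p v ⟧)       ≡⟨ ∑-cong (tuples t xs) (λ v → ⟦⟧-∧ (p x) (all p v)) ⟩
    ∑ (tuples t xs) (λ v → ⟦ p x ⟧ * ⟦ all p v ⟧)   ≡⟨ ∑-*ˡ (tuples t xs) ⟦ p x ⟧ _ ⟩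
    ⟦ p x ⟧ * ∑ (tuples t xs) (λ v → ⟦ all p v ⟧)   ≡⟨ cong (⟦ p x ⟧ *_) (∑-tuples-all t xs p) ⟩
    ⟦ p x ⟧ * ∑ xs (λ y → ⟦ p y ⟧) ^ t              ∎

all-true : ∀ (ys : List B) → all (λ _ → true) ys ≡ true
all-true []       = refl
all-true (y ∷ ys) = all-true ys

all-∧ : ∀ (ys : List B) p q → all (λ y → p y ∧ q y) ys ≡ all p ys ∧ all q ys
all-∧ []       p q = refl
all-∧ (y ∷ ys) p q with p y | q y
... | true  | true  = all-∧ ys p q
... | true  | false = ∧-comm false (all p ys)
... | false | _     = refl

all-swap : ∀ (xs : List A) (ys : List B) (R : A → B → Bool) →
           all (λ x → all (R x) ys) xs ≡ all (λ y → all (λ x → R x y) xs) ys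
all-swap []       ys R = sym (all-true ys)
all-swap (x ∷ xs) ys R = trans (cong (all (R x) ys ∧_) (all-swap xs ys R)) (sym (all-∧ ys (R x) _))

-- Dependent random choice

module _ (ys : List B) (R : A → B → Bool) where

  commonDegree : List A → ℕ
  commonDegree D = ∑ ys (λ y → ⟦ all (λ x → R x y) D ⟧)

  -- `a` is an inverse density, `suc t` the number of vertices sampled from `ys`, and `X` their
  -- common neighbourhood. On average `X` has at least a proportion `1 / a ^ suc t` of `xs`; the
  -- further factor `a`, being at least 2, pays for the penalty on bad tuples.
  dependent-random-choice : ∀ (xs : List A) d t m a → 1 ≤ length xs → 2 ≤ a →
    length ys * length xs ≤ ∑ xs (λ x → ∑ ys (λ y → ⟦ R x y ⟧)) * a →
    a ^ suc (suc t) * m ^ suc t * length xs ^ d < length ys ^ suc t →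
    Σ (A → Bool) λ X →
      length xs ≤ ∑ xs (λ x → ⟦ X x ⟧) * a ^ suc (suc t) ×
      (∀ {D} → D ∈ₗ tuples d xs → T (all X D) → m < commonDegree D)
  dependent-random-choice xs d t m a 1≤M 2≤a dense small = nbrs S , large , good
    where
    open ≤-Reasoning
    M  = length xs
    N  = length ys
    t′ = suc t
    a′ = a ^ suc t′
    instance
      M≢0 : NonZero M
      M≢0 = >-nonZero 1≤M

    nbrs : List B → A → Bool
    nbrs S x = all (R x) S

    deg : A → ℕ
    deg x = ∑ ys (λ y → ⟦ R x y ⟧)

    isBad : List B → List A → Bool
    isBad S D = (commonDegree D ≤ᵇ m) ∧ all (nbrs S) D

    #bad #nbrs : List B → ℕ
    #bad  S = ∑ (tuples d xs) (λ D → ⟦ isBad S D ⟧)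
    #nbrs S = ∑ xs (λ x → ⟦ nbrs S x ⟧)

    ∑-#nbrs : ∑ (tuples t′ ys) #nbrs ≡ ∑ xs (λ x → deg x ^ t′)
    ∑-#nbrs = trans (∑-swap (tuples t′ ys) xs _) (∑-cong xs (λ x → ∑-tuples-all t′ ys (R x)))

    -- `D` lies in `nbrs S` exactly when `S` lies in the common neighbourhood of `D`. For a tuple
    -- that can be bad this has at most `m` elements, leaving at most `m ^ t′` samples.
    bad-contribution : ∀ D → ∑ (tuples t′ ys) (λ S → ⟦ isBad S D ⟧) ≤ m ^ t′
    bad-contribution D with commonDegree D ≤ᵇ m in eq
    ... | false = ≤-trans (≤-reflexive (trans (∑-const (tuples t′ ys) 0) (*-zeroʳ (length (tuples t′ ys))))) z≤n
    ... | true  = begin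
      ∑ (tuples t′ ys) (λ S → ⟦ all (nbrs S) D ⟧)                   ≡⟨ ∑-cong (tuples t′ ys) (λ S → cong ⟦_⟧ (all-swap D S R)) ⟩
      ∑ (tuples t′ ys) (λ S → ⟦ all (λ y → all (λ x → R x y) D) S ⟧) ≡⟨ ∑-tuples-all t′ ys _ ⟩
      commonDegree D ^ t′                                          ≤⟨ ^-monoˡ-≤ t′ (≤ᵇ⇒≤ (commonDegree D) m (subst T (sym eq) _)) ⟩
      m ^ t′                                                       ∎

    ∑-#bad : ∑ (tuples t′ ys) #bad ≤ M ^ d * m ^ t′
    ∑-#bad = begin
      ∑ (tuples t′ ys) #bad                                           ≡⟨ ∑-swap (tuples t′ ys) (tuples d xs) _ ⟩
      ∑ (tuples d xs) (λ D → ∑ (tuples t′ ys) (λ S → ⟦ isBad S D ⟧))  ≤⟨ ∑-mono (tuples d xs) bad-contribution ⟩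
      ∑ (tuples d xs) (λ _ → m ^ t′)                                  ≡⟨ ∑-const (tuples d xs) _ ⟩
      length (tuples d xs) * m ^ t′                                   ≡⟨ cong (_* m ^ t′) (length-tuples d xs) ⟩
      M ^ d * m ^ t′                                                  ∎

    moment : N ^ t′ * M ≤ a ^ t′ * ∑ xs (λ x → deg x ^ t′)
    moment = *-cancelˡ-≤ (M ^ t) {{m^n≢0 M t}} (begin
      M ^ t * (N ^ t′ * M)                        ≡⟨ shuffle (M ^ t) (N ^ t′) M ⟩
      N ^ t′ * M ^ t′                             ≡⟨ ^-distribʳ-* t′ N M ⟨
      (N * M) ^ t′                                ≤⟨ ^-monoˡ-≤ t′ dense ⟩
      (∑ xs deg * a) ^ t′                         ≡⟨ ^-distribʳ-* t′ (∑ xs deg) a ⟩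
      ∑ xs deg ^ t′ * a ^ t′                      ≤⟨ *-monoˡ-≤ (a ^ t′) (power-mean xs deg t) ⟩
      M ^ t * ∑ xs (λ x → deg x ^ t′) * a ^ t′    ≡⟨ shuffle′ (M ^ t) _ (a ^ t′) ⟩
      M ^ t * (a ^ t′ * ∑ xs (λ x → deg x ^ t′))  ∎)
      where
      shuffle : ∀ p q r → p * (q * r) ≡ q * (r * p)
      shuffle = solve-∀
      shuffle′ : ∀ p q r → p * q * r ≡ p * (r * q)
      shuffle′ = solve-∀

    -- A single bad tuple already outweighs all of nbrs S, because #nbrs S ≤ M.
    penalty : List B → ℕ
    penalty S = a′ * M * #bad S + M

    average : ∑ (tuples t′ ys) penalty < ∑ (tuples t′ ys) (λ S → a′ * #nbrs S)
    average = begin-strict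
      ∑ (tuples t′ ys) penalty                         ≡⟨ ∑-+ (tuples t′ ys) _ _ ⟩
      ∑ (tuples t′ ys) (λ S → a′ * M * #bad S) + ∑ (tuples t′ ys) (λ _ → M)
        ≡⟨ cong₂ _+_ (∑-*ˡ (tuples t′ ys) (a′ * M) #bad)
             (trans (∑-const (tuples t′ ys) M) (cong (_* M) (length-tuples t′ ys))) ⟩
      a′ * M * ∑ (tuples t′ ys) #bad + N ^ t′ * M      ≤⟨ +-monoˡ-≤ _ (*-monoʳ-≤ (a′ * M) ∑-#bad) ⟩
      a′ * M * (M ^ d * m ^ t′) + N ^ t′ * M           ≡⟨ cong (_+ N ^ t′ * M) (shuffle a′ M (M ^ d) (m ^ t′)) ⟩
      -- By `small` the bad tuples cost no more than the constant term `N ^ t′ * M`. The resulting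
      -- factor 2 is absorbed by the spare `a`.
      a′ * m ^ t′ * M ^ d * M + N ^ t′ * M             <⟨ +-monoˡ-< _ (*-monoˡ-< M small) ⟩
      N ^ t′ * M + N ^ t′ * M                          ≡⟨ double (N ^ t′ * M) ⟩
      2 * (N ^ t′ * M)                                 ≤⟨ *-mono-≤ 2≤a moment ⟩
      a * (a ^ t′ * ∑ xs (λ x → deg x ^ t′))           ≡⟨ *-assoc a (a ^ t′) _ ⟨
      a′ * ∑ xs (λ x → deg x ^ t′)                     ≡⟨ cong (a′ *_) ∑-#nbrs ⟨
      a′ * ∑ (tuples t′ ys) #nbrs                      ≡⟨ ∑-*ˡ (tuples t′ ys) a′ #nbrs ⟨
      ∑ (tuples t′ ys) (λ S → a′ * #nbrs S)            ∎
      where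
      shuffle : ∀ p q r s → p * q * (r * s) ≡ p * s * r * q
      shuffle = solve-∀
      double : ∀ p → p + p ≡ 2 * p
      double = solve-∀

    S     = proj₁ (∑-<⇒∃-< (tuples t′ ys) average)
    above = proj₂ (∑-<⇒∃-< (tuples t′ ys) average)

    large : M ≤ #nbrs S * a′
    large = begin
      M             ≤⟨ m≤n+m M _ ⟩
      penalty S     ≤⟨ <⇒≤ above ⟩
      a′ * #nbrs S  ≡⟨ *-comm a′ _ ⟩
      #nbrs S * a′  ∎

    #nbrs≤M : #nbrs S ≤ M
    #nbrs≤M = begin
      #nbrs S         ≤⟨ ∑-mono xs (λ x → ⟦⟧≤1 (nbrs S x)) ⟩
      ∑ xs (λ _ → 1)  ≡⟨ ∑-1 xs ⟩
      M               ∎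

    no-bad : #bad S ≡ 0
    no-bad with #bad S in eq
    ... | zero  = refl
    ... | suc b = contradiction above (≤⇒≯ (begin
      a′ * #nbrs S             ≤⟨ *-monoʳ-≤ a′ #nbrs≤M ⟩
      a′ * M                   ≡⟨ *-identityʳ (a′ * M) ⟨
      a′ * M * 1               ≤⟨ *-monoʳ-≤ (a′ * M) (s≤s z≤n) ⟩
      a′ * M * suc b           ≡⟨ cong (a′ * M *_) eq ⟨
      a′ * M * #bad S          ≤⟨ m≤m+n _ M ⟩
      penalty S                ∎))

    good : ∀ {D} → D ∈ₗ tuples d xs → T (all (nbrs S) D) → m < commonDegree D
    good {D} D∈ allD = ≰⇒> λ deg≤m →
      contradiction (subst (1 ≤_) no-bad (≤-trans (bad≥1 (≤⇒≤ᵇ deg≤m) allD) (∑-member (λ D → ⟦ isBad S D ⟧) D∈))) λ ()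
      where
      bad≥1 : ∀ {a b} → T a → T b → 1 ≤ ⟦ a ∧ b ⟧
      bad≥1 {true} {true} _ _ = ≤-refl

-- Counting distinct elements

⟦∨⟧≤ : ∀ a b → ⟦ a ∨ b ⟧ ≤ ⟦ a ⟧ + ⟦ b ⟧
⟦∨⟧≤ false b = ≤-refl
⟦∨⟧≤ true  b = s≤s z≤n

module _ (_≟_ : DecidableEquality A) where
  open DecMembership _≟_ using () renaming (_∈?_ to _∈ₗ?_)

  ∑-≟≡0 : ∀ {xs l} → All (l ≢_) xs → ∑ xs (λ x → ⟦ does (x ≟ l) ⟧) ≡ 0
  ∑-≟≡0 [] = refl
  ∑-≟≡0 {x ∷ xs} {l} (l≢x ∷ l∉xs) with x ≟ l
  ... | yes refl = contradiction refl l≢x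
  ... | no  _    = ∑-≟≡0 l∉xs

  ∑-≟≤1 : ∀ {xs} l → Unique xs → ∑ xs (λ x → ⟦ does (x ≟ l) ⟧) ≤ 1
  ∑-≟≤1 l [] = z≤n
  ∑-≟≤1 {x ∷ xs} l (x∉xs ∷ u) with x ≟ l
  ... | yes refl = s≤s (≤-reflexive (∑-≟≡0 x∉xs))
  ... | no  _    = ∑-≟≤1 l u

  ∑-≟≥1 : ∀ {xs l} → l ∈ₗ xs → 1 ≤ ∑ xs (λ x → ⟦ does (x ≟ l) ⟧)
  ∑-≟≥1 {xs} {l} l∈xs = subst (λ b → ⟦ b ⟧ ≤ ∑ xs (λ x → ⟦ does (x ≟ l) ⟧))
    (dec-true (l ≟ l) refl) (∑-member (λ x → ⟦ does (x ≟ l) ⟧) l∈xs)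

  ∑-∈?≤length : ∀ {xs} L → Unique xs → ∑ xs (λ x → ⟦ does (x ∈ₗ? L) ⟧) ≤ length L
  ∑-∈?≤length {xs} [] u = ≤-reflexive (trans (∑-const xs 0) (*-zeroʳ (length xs)))
  ∑-∈?≤length {xs} (l ∷ L) u = begin
    ∑ xs (λ x → ⟦ does (x ≟ l) ∨ does (x ∈ₗ? L) ⟧)               ≤⟨ ∑-mono xs (λ x → ⟦∨⟧≤ (does (x ≟ l)) _) ⟩
    ∑ xs (λ x → ⟦ does (x ≟ l) ⟧ + ⟦ does (x ∈ₗ? L) ⟧)           ≡⟨ ∑-+ xs _ _ ⟩
    ∑ xs (λ x → ⟦ does (x ≟ l) ⟧) + ∑ xs (λ x → ⟦ does (x ∈ₗ? L) ⟧)  ≤⟨ +-mono-≤ (∑-≟≤1 l u) (∑-∈?≤length L u) ⟩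
    suc (length L)                                              ∎
    where open ≤-Reasoning

  length≤∑-∈? : ∀ {xs L} → Unique L → All (_∈ₗ xs) L → length L ≤ ∑ xs (λ x → ⟦ does (x ∈ₗ? L) ⟧)
  length≤∑-∈? [] [] = z≤n
  length≤∑-∈? {xs} {l ∷ L} (l∉L ∷ u) (l∈xs ∷ L⊆xs) = begin
    suc (length L)                                                  ≤⟨ +-mono-≤ (∑-≟≥1 l∈xs) (length≤∑-∈? u L⊆xs) ⟩
    ∑ xs (λ x → ⟦ does (x ≟ l) ⟧) + ∑ xs (λ x → ⟦ does (x ∈ₗ? L) ⟧)  ≡⟨ ∑-+ xs _ _ ⟨
    ∑ xs (λ x → ⟦ does (x ≟ l) ⟧ + ⟦ does (x ∈ₗ? L) ⟧)               ≤⟨ ∑-mono xs exclusive ⟩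
    ∑ xs (λ x → ⟦ does (x ≟ l) ∨ does (x ∈ₗ? L) ⟧)                   ∎
    where
    open ≤-Reasoning
    exclusive : ∀ x → ⟦ does (x ≟ l) ⟧ + ⟦ does (x ∈ₗ? L) ⟧ ≤ ⟦ does (x ≟ l) ∨ does (x ∈ₗ? L) ⟧
    exclusive x with x ≟ l
    ... | no  _    = ≤-refl
    ... | yes refl = ≤-reflexive (cong (λ b → suc ⟦ b ⟧) (dec-false (x ∈ₗ? L) (All¬⇒¬Any l∉L)))

  fresh-element : ∀ {xs} (p : A → Bool) L → Unique xs → length L < ∑ xs (λ x → ⟦ p x ⟧) →
                  ∃ λ y → T (p y) × y ∉ₗ L
  fresh-element {xs} p L u lt = y , satisfied , avoids
    where
    found = ∑-<⇒∃-< xs {λ x → ⟦ does (x ∈ₗ? L) ⟧} {λ x → ⟦ p x ⟧} (≤-<-trans (∑-∈?≤length L u) lt)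
    y = proj₁ found
    satisfied : T (p y)
    satisfied with p y | proj₂ found
    ... | true | _ = _
    avoids : y ∉ₗ L
    avoids y∈L with p y | subst (λ b → ⟦ b ⟧ < ⟦ p y ⟧) (dec-true (y ∈ₗ? L) y∈L) (proj₂ found)
    ... | true | s≤s ()

-- Embedding one class at a time

updateAt-injective : ∀ {m n} {φ : Fin m → Fin n} v {y} → Injective _≡_ _≡_ φ → (∀ u → φ u ≢ y) →
                     Injective _≡_ _≡_ (updateAt φ v (λ _ → y))
updateAt-injective {φ = φ} v {y} inj y∉ {a} {b} eq with a FinP.≟ v | b FinP.≟ v
... | yes refl | yes refl = refl
... | yes refl | no b≢v =
  contradiction (trans (sym (updateAt-minimal b a φ b≢v)) (trans (sym eq) (updateAt-updates a φ))) (y∉ b)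
... | no a≢v | yes refl =
  contradiction (trans (sym (updateAt-minimal a b φ a≢v)) (trans eq (updateAt-updates b φ))) (y∉ a)
... | no a≢v | no b≢v =
  inj (trans (sym (updateAt-minimal a v φ a≢v)) (trans eq (updateAt-minimal b v φ b≢v)))

-- Higher classes come first, so that dropping the head of a tuple passes to the trace on the lower classes.
prefix : (ℕ → B → A) → ℕ → B → List A
prefix top zero    e = []
prefix top (suc k) e = top k e ∷ prefix top k e

length-prefix : ∀ (top : ℕ → B → A) k e → length (prefix top k e) ≡ k
length-prefix top zero    e = refl
length-prefix top (suc k) e = cong suc (length-prefix top k e)

∈-prefix : ∀ (top : ℕ → B → A) {j k} e → j < k → top j e ∈ₗ prefix top k e
∈-prefix top {j} {suc k} e (s≤s j≤k) with m≤n⇒m<n∨m≡n j≤k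
... | inj₁ j<k  = there (∈-prefix top e j<k)
... | inj₂ refl = here refl

-- What the embedding needs to know of `H`. `prefix vertex j e` stands for the trace of `e` below
-- class `j`, and `covered` is trace-boundedness: at most `d` such prefixes lie under one vertex.
-- The index of `vertex` is an unbounded `ℕ`; only values below `r` carry meaning.
record LayeredGraph (r d m : ℕ) : Set₁ where
  field
    {Edge}    : Set
    edgeList  : List Edge
    vertex    : ℕ → Edge → Fin m
    layer     : Fin m → ℕ
    layer-vertex : ∀ {e j} → e ∈ₗ edgeList → j < r → layer (vertex j e) ≡ j
    covered   : ∀ {j} → j < r → ∀ v → Σ (List (List (Fin m))) λ D → length D ≤ d ×
                  (∀ {e} → e ∈ₗ edgeList → vertex j e ≡ v → prefix vertex j e ∈ₗ D)

  -- Only the lowest `k` classes are constrained, yet `φ` is injective on all vertices: those of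
  -- higher classes hold provisional images until their own class is reached.
  EmbedsIn : ∀ {n} → ℕ → (List (Fin n) → Bool) → Set
  EmbedsIn {n} k E = Σ (Fin m → Fin n) λ φ → Injective _≡_ _≡_ φ ×
    (∀ {e} → e ∈ₗ edgeList → T (E (map φ (prefix vertex k e))))

module _ {r d m : ℕ} (H : LayeredGraph r d m) where
  open LayeredGraph H

  layer-prefix : ∀ {k e} → k ≤ r → e ∈ₗ edgeList → All (λ u → layer u < k) (prefix vertex k e)
  layer-prefix {zero}  k≤r e∈ = []
  layer-prefix {suc k} k<r e∈ =
    s≤s (≤-reflexive (layer-vertex e∈ k<r)) ∷ All.map m<n⇒m<1+n (layer-prefix (<⇒≤ k<r) e∈)

  -- The vertices of class `k` are moved one by one. The at most `d` prefixes under such a vertex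
  -- have images in `E′`, so by `rich` these have more than `m` common neighbours, which the `m`
  -- current images cannot use up.
  extend-embedding : ∀ {n k} → k < r → (E E′ : List (Fin n) → Bool) →
    (∀ {D} → D ∈ₗ tuples d (tuples k (allFin n)) → T (all E′ D) →
      m < commonDegree (allFin n) (λ x y → E (y ∷ x)) D) →
    EmbedsIn k E′ → EmbedsIn (suc k) E
  extend-embedding {n} {k} k<r E E′ rich (φ₀ , inj₀ , ok₀) =
    let φ , inj , _ , ok = embed-top (allFin m) in φ , inj , λ {e} e∈ → ok e∈ (∈-allFin (vertex k e))
    where
    prefixes = map (prefix vertex k) edgeList
    open DecMembership (List-≡-dec {A = Fin m} FinP._≟_) using () renaming (_∈?_ to _∈ₗ?_)

    -- Invariant: vertices below class `k` keep their image under `φ₀`, and edges whose class-`k`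
    -- vertex is in `vs` are already embedded.
    embed-top : ∀ vs → Σ (Fin m → Fin n) λ φ → Injective _≡_ _≡_ φ ×
      (∀ {u} → layer u < k → φ u ≡ φ₀ u) ×
      (∀ {e} → e ∈ₗ edgeList → vertex k e ∈ₗ vs → T (E (map φ (prefix vertex (suc k) e))))
    embed-top []       = φ₀ , inj₀ , (λ _ → refl) , λ _ ()
    embed-top (v ∷ vs) with embed-top vs | any? (λ e → vertex k e FinP.≟ v) edgeList
    ... | φ , inj , agree , ok | no v∉ =
      φ , inj , agree ,
      λ { e∈ (here eq) → contradiction (lose e∈ eq) v∉ ; e∈ (there ∈vs) → ok e∈ ∈vs }
    ... | φ , inj , agree , ok | yes v∈ = φ′ , inj′ , agree′ , ok′
      where
      e₀  = proj₁ (find v∈)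
      e₀∈ = proj₁ (proj₂ (find v∈))
      D   = proj₁ (covered k<r v)
      -- `rich` speaks of exactly `d` tuples, all in `E′`. Entries of `D` that are no prefix of an
      -- edge are therefore dropped, and the prefix of `e₀` is repeated to fill up to `d`.
      D₁  = filter (_∈ₗ? prefixes) D
      D₂  = D₁ ++ replicate (d ∸ length D₁) (prefix vertex k e₀)
      D₃  = map (map φ₀) D₂

      layer-v : layer v ≡ k
      layer-v = trans (cong layer (sym (proj₂ (proj₂ (find v∈))))) (layer-vertex e₀∈ k<r)

      D₂⊆ : All (_∈ₗ prefixes) D₂
      D₂⊆ = AllP.++⁺ (AllP.all-filter (_∈ₗ? prefixes) D) (AllP.replicate⁺ _ (∈-map⁺ _ e₀∈))

      length-D₃ : length D₃ ≡ d
      length-D₃ = begin-equality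
        length D₃                                   ≡⟨ length-map (map φ₀) D₂ ⟩
        length D₂                                   ≡⟨ length-++ D₁ ⟩
        length D₁ + length (replicate (d ∸ length D₁) (prefix vertex k e₀))
                                                    ≡⟨ cong (length D₁ +_) (length-replicate (d ∸ length D₁)) ⟩
        length D₁ + (d ∸ length D₁)                 ≡⟨ m+[n∸m]≡n (≤-trans (length-filter _ D) (proj₁ (proj₂ (covered k<r v)))) ⟩
        d                                           ∎
        where open ≤-Reasoning

      is-tuple : ∀ {x} → x ∈ₗ prefixes → map φ₀ x ∈ₗ tuples k (allFin n)
      is-tuple x∈ with ∈-map⁻ _ x∈
      ... | e , _ , refl = subst (λ l → map φ₀ (prefix vertex k e) ∈ₗ tuples l (allFin n))
        (trans (length-map φ₀ (prefix vertex k e)) (length-prefix vertex k e))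
        (∈-tuples (All.tabulate λ {y} _ → ∈-allFin y))

      in-E′ : ∀ {x} → x ∈ₗ prefixes → T (E′ (map φ₀ x))
      in-E′ x∈ with ∈-map⁻ _ x∈
      ... | e , e∈ , refl = ok₀ e∈

      many : m < commonDegree (allFin n) (λ x y → E (y ∷ x)) D₃
      many = rich
        (subst (λ l → D₃ ∈ₗ tuples l (tuples k (allFin n))) length-D₃
          (∈-tuples (AllP.map⁺ (All.map is-tuple D₂⊆))))
        (AllP.all⁻ E′ (AllP.map⁺ (All.map in-E′ D₂⊆)))

      -- All `m` current images are avoided, the provisional ones included, so that `φ′` stays
      -- injective.
      fresh = fresh-element FinP._≟_ (λ y → all (λ x → E (y ∷ x)) D₃) (map φ (allFin m)) (allFin⁺ n)
        (subst (_< commonDegree (allFin n) (λ x y → E (y ∷ x)) D₃)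
          (sym (trans (length-map φ (allFin m)) (length-tabulate {n = m} (λ i → i)))) many)
      y = proj₁ fresh

      φ′ : Fin m → Fin n
      φ′ = updateAt φ v (λ _ → y)

      inj′ : Injective _≡_ _≡_ φ′
      inj′ = updateAt-injective v inj λ u φu≡y →
        proj₂ (proj₂ fresh) (subst (_∈ₗ map φ (allFin m)) φu≡y (∈-map⁺ φ (∈-allFin u)))

      agree′ : ∀ {u} → layer u < k → φ′ u ≡ φ₀ u
      agree′ {u} lu<k = trans (updateAt-minimal u v φ λ { refl → <-irrefl layer-v lu<k }) (agree lu<k)

      agree-prefix : ∀ {ψ} → (∀ {u} → layer u < k → ψ u ≡ φ₀ u) → ∀ {e} → e ∈ₗ edgeList →
                     map ψ (prefix vertex k e) ≡ map φ₀ (prefix vertex k e)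
      agree-prefix ag e∈ = map-cong-local (All.map ag (layer-prefix (<⇒≤ k<r) e∈))

      ok′ : ∀ {e} → e ∈ₗ edgeList → vertex k e ∈ₗ (v ∷ vs) → T (E (map φ′ (prefix vertex (suc k) e)))
      ok′ {e} e∈ e∈vs with vertex k e FinP.≟ v | e∈vs
      ... | yes refl | _ = subst T (cong E (sym (cong₂ _∷_ (updateAt-updates v φ) (agree-prefix agree′ e∈))))
        (All.lookup (AllP.map⁻ (AllP.all⁺ _ D₃ (proj₁ (proj₂ fresh))))
          (∈-++⁺ˡ (∈-filter⁺ (_∈ₗ? prefixes) (proj₂ (proj₂ (covered k<r v)) e∈ refl) (∈-map⁺ _ e∈))))
      ... | no e≢v | here eq    = contradiction eq e≢v
      ... | no e≢v | there e∈vs = subst T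
        (cong E (sym (cong₂ _∷_ (updateAt-minimal _ v φ e≢v)
          (trans (agree-prefix agree′ e∈) (sym (agree-prefix agree e∈))))))
        (ok e∈ e∈vs)

  -- Random choice repeated down the classes.

  choose-neighbourhood : ∀ {n} k t a (E : List (Fin n) → Bool) → 1 ≤ n → 2 ≤ a →
    n ^ suc k ≤ ∑ (tuples (suc k) (allFin n)) (λ x → ⟦ E x ⟧) * a →
    a ^ suc (suc t) * m ^ suc t * (n ^ k) ^ d < n ^ suc t →
    Σ (List (Fin n) → Bool) λ E′ →
      n ^ k ≤ ∑ (tuples k (allFin n)) (λ x → ⟦ E′ x ⟧) * a ^ suc (suc t) ×
      (∀ {D} → D ∈ₗ tuples d (tuples k (allFin n)) → T (all E′ D) →
        m < commonDegree (allFin n) (λ x y → E (y ∷ x)) D)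
  choose-neighbourhood {n} k t a E 1≤n 2≤a dense small =
    let E′ , large , rich = dependent-random-choice (allFin n) (λ x y → E (y ∷ x)) xs d t m a
          (subst (1 ≤_) (sym |xs|) (m^n>0 n {{>-nonZero 1≤n}} k)) 2≤a dense′
          (subst₂ (λ M N → a ^ suc (suc t) * m ^ suc t * M ^ d < N ^ suc t) (sym |xs|) (sym |ys|) small)
    in E′ , subst (_≤ ∑ xs (λ x → ⟦ E′ x ⟧) * a ^ suc (suc t)) |xs| large , rich
    where
    open ≤-Reasoning
    xs = tuples k (allFin n)
    |ys| : length (allFin n) ≡ n
    |ys| = length-tabulate {n = n} (λ i → i)
    |xs| : length xs ≡ n ^ k
    |xs| = trans (length-tuples k (allFin n)) (cong (_^ k) |ys|)
    dense′ : length (allFin n) * length xs ≤ ∑ xs (λ x → ∑ (allFin n) (λ y → ⟦ E (y ∷ x) ⟧)) * a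
    dense′ = begin
      length (allFin n) * length xs                            ≡⟨ cong₂ _*_ |ys| |xs| ⟩
      n ^ suc k                                                ≤⟨ dense ⟩
      ∑ (tuples (suc k) (allFin n)) (λ x → ⟦ E x ⟧) * a        ≡⟨ cong (_* a) (∑-tuples k (allFin n) _) ⟩
      ∑ (allFin n) (λ y → ∑ xs (λ x → ⟦ E (y ∷ x) ⟧)) * a      ≡⟨ cong (_* a) (∑-swap (allFin n) xs _) ⟩
      ∑ xs (λ x → ∑ (allFin n) (λ y → ⟦ E (y ∷ x) ⟧)) * a      ∎

  -- Each round above the bottom one turns the inverse density `a` into `a ^ suc (suc t)`, and the
  -- bottom round squares it, whence the exponent `2 * suc (suc t) ^ k`. Bounding this final value
  -- serves all earlier rounds too.
  dense⇒embeds : ∀ {n} t k a (E : List (Fin n) → Bool) → suc k ≤ r → 1 ≤ d → r * d ≤ suc t → 2 ≤ a →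
    n ^ suc k ≤ ∑ (tuples (suc k) (allFin n)) (λ x → ⟦ E x ⟧) * a →
    a ^ (2 * suc (suc t) ^ k) * m ^ suc t < n →
    EmbedsIn (suc k) E
  -- The bottom class needs only one random vertex; t of them would cost another factor of t + 1 in the exponent.
  dense⇒embeds {n} t zero a E k<r 1≤d rd≤t 2≤a dense small =
    let E′ , large , rich = choose-neighbourhood 0 0 a E (≤-trans (s≤s z≤n) small) 2≤a dense small′
    in extend-embedding k<r E E′ rich
         -- With no class placed yet, the one requirement is that `E′` holds of the empty tuple,
         -- which its positive density gives; any injection will do.
         ((λ i → inject≤ i m≤n) , inject≤-injective m≤n m≤n _ _ , λ _ → positive (E′ []) large)
    where
    open ≤-Reasoning
    instance
      a≢0 : NonZero a
      a≢0 = >-nonZero (≤-trans (s≤s z≤n) 2≤a)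
    small′ : a ^ 2 * m ^ 1 * 1 ^ d < n ^ 1
    small′ = begin-strict
      a ^ 2 * m ^ 1 * 1 ^ d  ≡⟨ cong (a ^ 2 * m ^ 1 *_) (^-zeroˡ d) ⟩
      a ^ 2 * m ^ 1 * 1      ≡⟨ *-identityʳ _ ⟩
      a ^ 2 * m ^ 1          ≡⟨ cong (a ^ 2 *_) (*-identityʳ m) ⟩
      a ^ 2 * m              ≤⟨ *-monoʳ-≤ (a ^ 2) (m≤m^1+n m t) ⟩
      a ^ 2 * m ^ suc t      <⟨ small ⟩
      n                      ≡⟨ *-identityʳ n ⟨
      n ^ 1                  ∎
    m≤n : m ≤ n
    m≤n = begin
      m                      ≤⟨ m≤m^1+n m t ⟩
      m ^ suc t              ≤⟨ m≤n*m _ (a ^ 2) {{m^n≢0 a 2}} ⟩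
      a ^ 2 * m ^ suc t      ≤⟨ <⇒≤ small ⟩
      n                      ∎
    positive : ∀ b {c} → 1 ≤ (⟦ b ⟧ + 0) * c → T b
    positive true _ = _
  dense⇒embeds {n} t (suc k) a E k<r 1≤d rd≤t 2≤a dense small =
    let E′ , large , rich = choose-neighbourhood (suc k) t a E 1≤n 2≤a dense small′
    in extend-embedding k<r E E′ rich
         (dense⇒embeds t k a′ E′ (<⇒≤ k<r) 1≤d rd≤t 2≤a′ large
           (subst (λ b → b * m ^ suc t < n) (sym a′-power) small))
    where
    open ≤-Reasoning
    a′ = a ^ suc (suc t)
    instance
      a≢0 : NonZero a
      a≢0 = >-nonZero (≤-trans (s≤s z≤n) 2≤a)
    1≤n : 1 ≤ n
    1≤n = ≤-trans (s≤s z≤n) small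
    instance
      n≢0 : NonZero n
      n≢0 = >-nonZero 1≤n
    2≤a′ : 2 ≤ a′
    2≤a′ = ≤-trans 2≤a (m≤m^1+n a (suc t))
    a′-power : a′ ^ (2 * suc (suc t) ^ k) ≡ a ^ (2 * suc (suc t) ^ suc k)
    a′-power = trans (^-*-assoc a (suc (suc t)) (2 * suc (suc t) ^ k)) (cong (a ^_) (shuffle (suc (suc t)) (suc (suc t) ^ k)))
      where
      shuffle : ∀ s p → s * (2 * p) ≡ 2 * (s * p)
      shuffle = solve-∀
    -- One factor `n` absorbs `a′ * m ^ suc t`, and `suc k * d` more count the `d`-tuples of
    -- `suc k`-tuples. The `suc t` random vertices make room for both because `suc (suc k)` is at
    -- most `r`.
    exponent : 1 + suc k * d ≤ suc t
    exponent = begin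
      1 + suc k * d    ≤⟨ +-monoˡ-≤ (suc k * d) 1≤d ⟩
      suc (suc k) * d  ≤⟨ *-monoˡ-≤ d k<r ⟩
      r * d            ≤⟨ rd≤t ⟩
      suc t            ∎
    a′m<n : a′ * m ^ suc t < n
    a′m<n = begin-strict
      a′ * m ^ suc t                             ≤⟨ *-monoˡ-≤ (m ^ suc t) (^-monoʳ-≤ a power) ⟩
      a ^ (2 * suc (suc t) ^ suc k) * m ^ suc t  <⟨ small ⟩
      n                                          ∎
      where
      power : suc (suc t) ≤ 2 * suc (suc t) ^ suc k
      power = ≤-trans (m≤m^1+n (suc (suc t)) k) (m≤n*m _ 2)
    small′ : a′ * m ^ suc t * (n ^ suc k) ^ d < n ^ suc t
    small′ = begin-strict
      a′ * m ^ suc t * (n ^ suc k) ^ d  <⟨ *-monoˡ-< ((n ^ suc k) ^ d) {{m^n≢0 (n ^ suc k) d {{m^n≢0 n (suc k)}}}} a′m<n ⟩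
      n * (n ^ suc k) ^ d               ≡⟨ cong (n *_) (^-*-assoc n (suc k) d) ⟩
      n ^ (1 + suc k * d)               ≤⟨ ^-monoʳ-≤ n exponent ⟩
      n ^ suc t                         ∎

-- From r-graphs to sets of tuples

elements : ∀ {n} → Subset n → List (Fin n)
elements []          = []
elements (true  ∷ S) = zero ∷ map suc (elements S)
elements (false ∷ S) = map suc (elements S)

length-elements : ∀ {n} (S : Subset n) → length (elements S) ≡ ∣ S ∣
length-elements []          = refl
length-elements (true  ∷ S) = cong suc (trans (length-map suc (elements S)) (length-elements S))
length-elements (false ∷ S) = trans (length-map suc (elements S)) (length-elements S)

∈-elements⁺ : ∀ {n x} {S : Subset n} → x ∈ S → x ∈ₗ elements S
∈-elements⁺ {S = true  ∷ S} here        = here refl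
∈-elements⁺ {S = true  ∷ S} (there x∈S) = there (∈-map⁺ suc (∈-elements⁺ x∈S))
∈-elements⁺ {S = false ∷ S} (there x∈S) = ∈-map⁺ suc (∈-elements⁺ x∈S)

∈-elements⁻ : ∀ {n x} (S : Subset n) → x ∈ₗ elements S → x ∈ S
∈-elements⁻ (true  ∷ S) (here refl) = here
∈-elements⁻ (true  ∷ S) (there x∈)  with ∈-map⁻ suc x∈
... | _ , y∈ , refl = there (∈-elements⁻ S y∈)
∈-elements⁻ (false ∷ S) x∈          with ∈-map⁻ suc x∈
... | _ , y∈ , refl = there (∈-elements⁻ S y∈)

elements-injective : ∀ {n} {S S′ : Subset n} → elements S ≡ elements S′ → S ≡ S′
elements-injective {S = S} {S′} eq = ⊆-antisym
  (λ x∈ → ∈-elements⁻ S′ (subst (_ ∈ₗ_) eq (∈-elements⁺ x∈)))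
  (λ x∈ → ∈-elements⁻ S (subst (_ ∈ₗ_) (sym eq) (∈-elements⁺ x∈)))

module _ {r n : ℕ} (G : RGraph r n) where
  open DecMembership (List-≡-dec {A = Fin n} FinP._≟_) using () renaming (_∈?_ to _∈ₗ?_)

  -- Each edge is represented only by its increasing listing. The embedding uses no symmetry in the
  -- order of a tuple, so one listing per edge suffices.
  isEdgeTuple : List (Fin n) → Bool
  isEdgeTuple x = does (x ∈ₗ? map elements (edges G))

  isEdgeTuple⁻ : ∀ {x} → T (isEdgeTuple x) → ∃ λ S → S ∈ₗ edges G × x ≡ elements S
  isEdgeTuple⁻ {x} p with x ∈ₗ? map elements (edges G)
  ... | yes x∈ = ∈-map⁻ elements x∈

  numEdges≤#edgeTuples : numEdges G ≤ ∑ (tuples r (allFin n)) (λ x → ⟦ isEdgeTuple x ⟧)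
  numEdges≤#edgeTuples = ≤-trans (≤-reflexive (sym (length-map elements (edges G))))
    (length≤∑-∈? (List-≡-dec FinP._≟_)
      (UniqueP.map⁺ elements-injective (distinct G))
      (AllP.map⁺ (All.map (λ {S} → is-tuple S) (uniform G))))
    where
    is-tuple : ∀ S → ∣ S ∣ ≡ r → elements S ∈ₗ tuples r (allFin n)
    is-tuple S |S|≡r = subst (λ l → elements S ∈ₗ tuples l (allFin n)) (trans (length-elements S) |S|≡r)
      (∈-tuples (All.tabulate λ {y} _ → ∈-allFin y))

-- From partite graphs to layered graphs

∈-lowerUnion : ∀ {r m} (H : PartiteGraph r m) i {u} → toℕ (part H u) ≤ toℕ i → u ∈ lowerUnion H i
∈-lowerUnion H i {u} le = lookup⇒[]= u (lowerUnion H i) in-lower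
  where
  in-lower : lookup (lowerUnion H i) u ≡ true
  in-lower with toℕ (part H u) ≤? toℕ i | (lookup (lowerUnion H i) u ≡ _) ∋ lookup∘tabulate _ u
  ... | yes _ | eq = eq
  ... | no ≰i | _  = contradiction le ≰i

module _ {r m : ℕ} (H : PartiteGraph r (suc m)) where

  class : Fin (suc m) → ℕ
  class v = toℕ (part H v)

  -- If no vertex of S lies in class j, the value is the junk vertex zero.
  vertexIn : ℕ → Subset (suc m) → Fin (suc m)
  vertexIn j S with FinP.any? (λ v → (v ∈? S) ×-dec (class v ≟ j))
  ... | yes (v , _) = v
  ... | no  _       = zero

  -- Stated for a subset `S′` of an edge so that it applies to traces, which need not be edges;
  -- uniqueness within a class is inherited from `S`.
  vertexIn-unique : ∀ {S S′ v} → S ∈ₗ pedges H → S′ ⊆ S → v ∈ S′ → vertexIn (class v) S′ ≡ v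
  vertexIn-unique {S} {S′} {v} S∈ S′⊆S v∈S′ with FinP.any? (λ u → (u ∈? S′) ×-dec (class u ≟ class v))
  ... | no  ∄ = contradiction (v , v∈S′ , refl) ∄
  ... | yes (u , u∈S′ , eq) with All.lookup (transversal H) S∈ (part H v)
  ...   | _ , _ , unique = trans (sym (unique (S′⊆S u∈S′ , FinP.toℕ-injective eq))) (unique (S′⊆S v∈S′ , refl))

  vertexIn-spec : ∀ {S j} → S ∈ₗ pedges H → j < r → vertexIn j S ∈ S × class (vertexIn j S) ≡ j
  vertexIn-spec {S} {j} S∈ j<r with All.lookup (transversal H) S∈ (fromℕ< j<r)
  ... | v , (v∈S , eq) , _ =
    subst (λ u → u ∈ S × class u ≡ j) (trans (sym unique) (cong (λ j → vertexIn j S) class-v)) (v∈S , class-v)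
    where
    class-v : class v ≡ j
    class-v = trans (cong toℕ eq) (FinP.toℕ-fromℕ< j<r)
    unique : vertexIn (class v) S ≡ v
    unique = vertexIn-unique S∈ (λ x∈ → x∈) v∈S

  -- The vertices of `S` below class `i` can be read off from its trace. Hence a bound on the
  -- distinct traces through a vertex bounds the prefixes under it.
  prefix-trace : ∀ {S i} k → S ∈ₗ pedges H → k ≤ toℕ i →
                 prefix vertexIn k (S ∩ lowerUnion H i) ≡ prefix vertexIn k S
  prefix-trace zero S∈ k≤i = refl
  prefix-trace {S} {i} (suc k) S∈ k<i = cong₂ _∷_ same (prefix-trace k S∈ (<⇒≤ k<i))
    where
    spec = vertexIn-spec S∈ (<-trans k<i (FinP.toℕ<n i))
    same : vertexIn k (S ∩ lowerUnion H i) ≡ vertexIn k S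
    same = trans (cong (λ j → vertexIn j (S ∩ lowerUnion H i)) (sym (proj₂ spec)))
      (vertexIn-unique S∈ (p∩q⊆p S (lowerUnion H i))
        (x∈p∩q⁺ (proj₁ spec , ∈-lowerUnion H i (≤-trans (≤-reflexive (proj₂ spec)) (<⇒≤ k<i)))))

  layered : ∀ {d} → 1 ≤ d → TraceBounded d H → LayeredGraph r d (suc m)
  layered {d} 1≤d bounded = record
    { edgeList     = pedges H
    ; vertex       = vertexIn
    ; layer        = class
    ; layer-vertex = λ S∈ j<r → proj₂ (vertexIn-spec S∈ j<r)
    ; covered      = covered
    }
    where
    covered : ∀ {j} → j < r → ∀ v → Σ (List (List (Fin (suc m)))) λ D → length D ≤ d ×
                (∀ {S} → S ∈ₗ pedges H → vertexIn j S ≡ v → prefix vertexIn j S ∈ₗ D)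
    -- Below the lowest class the only prefix is the empty one, and `1≤d` leaves room for it.
    covered {zero}    j<r v = ([] ∷ []) , 1≤d , λ _ _ → here refl
    covered {j@(suc _)} j<r v with class v ≟ j
    ... | no  ≢j = [] , z≤n , λ { S∈ refl → contradiction (proj₂ (vertexIn-spec S∈ j<r)) ≢j }
    ... | yes ≡j = map (prefix vertexIn j) traces ,
                   ≤-trans (≤-reflexive (length-map _ traces)) (bounded i 1≤i v refl) ,
                   cover
      where
      i = part H v
      1≤i : 1 ≤ toℕ i
      1≤i = subst (1 ≤_) (sym ≡j) (s≤s z≤n)
      traces = filter (λ S′ → v ∈? S′) (traceEdges H i)
      cover : ∀ {S} → S ∈ₗ pedges H → vertexIn j S ≡ v → prefix vertexIn j S ∈ₗ map (prefix vertexIn j) traces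
      cover {S} S∈ eq = subst (_∈ₗ map (prefix vertexIn j) traces) (prefix-trace j S∈ (≤-reflexive (sym ≡j)))
        (∈-map⁺ (prefix vertexIn j)
          (∈-filter⁺ (λ S′ → v ∈? S′)
            (∈-deduplicate⁺ (≡-dec Bool._≟_) (∈-map⁺ (λ S → S ∩ lowerUnion H i) S∈))
            (x∈p∩q⁺ (subst (_∈ S) eq (proj₁ (vertexIn-spec S∈ j<r)) , ∈-lowerUnion H i ≤-refl))))

  ∈-prefix⇔∈ : ∀ {S v} → S ∈ₗ pedges H → v ∈ₗ prefix vertexIn r S ⇔ v ∈ S
  ∈-prefix⇔∈ {S} {v} S∈ = mk⇔ (to r ≤-refl)
    (λ v∈S → subst (_∈ₗ prefix vertexIn r S) (vertexIn-unique S∈ (λ x∈ → x∈) v∈S)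
      (∈-prefix vertexIn S (FinP.toℕ<n (part H v))))
    where
    to : ∀ k → k ≤ r → v ∈ₗ prefix vertexIn k S → v ∈ S
    to (suc k) k<r (here refl) = proj₁ (vertexIn-spec S∈ k<r)
    to (suc k) k<r (there v∈)  = to k (<⇒≤ k<r) v∈

  embeds⇒containsCopy : ∀ {n d} (G : RGraph r n) (1≤d : 1 ≤ d) (bounded : TraceBounded d H) →
    LayeredGraph.EmbedsIn (layered 1≤d bounded) r (isEdgeTuple G) → ContainsCopy G H
  embeds⇒containsCopy G 1≤d bounded (φ , inj , ok) = φ , inj , All.tabulate copy
    where
    copy : ∀ {S} → S ∈ₗ pedges H → ∃ λ S′ → S′ ∈ₗ edges G × (∀ w → (w ∈ S′ ⇔ ∃ λ v → v ∈ S × φ v ≡ w))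
    copy {S} S∈ with isEdgeTuple⁻ G (ok S∈)
    ... | S′ , S′∈ , eq = S′ , S′∈ , λ w → mk⇔
      (λ w∈ → let v , v∈ , w≡ = ∈-map⁻ φ (subst (w ∈ₗ_) (sym eq) (∈-elements⁺ w∈))
              in v , Equivalence.to (∈-prefix⇔∈ S∈) v∈ , sym w≡)
      (λ { (v , v∈ , refl) → ∈-elements⁻ S′
             (subst (φ v ∈ₗ_) eq (∈-map⁺ φ (Equivalence.from (∈-prefix⇔∈ S∈) v∈))) })

-- Choice of parameters

-- Stands in for the real number `n ^ (1 / q)`. Later `suc l` is the inverse density:
-- `n < suc l ^ q` makes it large enough for the edge count, and `l ^ q ≤ n` keeps it small.
floor-root : ∀ q .{{_ : NonZero q}} n → ∃ λ l → l ^ q ≤ n × n < suc l ^ q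
floor-root q@(suc _) zero    = 0 , z≤n , m^n>0 1 q
floor-root q@(suc _) (suc n) with floor-root q n
... | l , l^q≤n , n<sl^q with suc l ^ q ≤? suc n
...   | yes ≤n = suc l , ≤n , ≤-<-trans n<sl^q (^-monoˡ-< q (n<1+n (suc l)))
...   | no  ≰n = l , m≤n⇒m≤1+n l^q≤n , ≰⇒> ≰n

-- With `y = r * d + 1` this bounds `suc K` by a pure power, which compares with
-- `(5 * r * d) ^ suc j` through the bases alone.
exponent-bound : ∀ y j → suc (2 * y ^ suc j) ≤ suc (2 * y) ^ suc j
exponent-bound y zero    = ≤-reflexive (cong suc (base y))
  where
  base : ∀ y → 2 * (y * 1) ≡ 2 * y * 1
  base = solve-∀
exponent-bound y (suc j) = begin
  suc (2 * (y * p))                           ≤⟨ m≤m+n _ (2 * (y * p) + 2 * y + 2 * p) ⟩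
  suc (2 * (y * p)) + (2 * (y * p) + 2 * y + 2 * p) ≡⟨ expand y p ⟩
  suc (2 * y) * suc (2 * p)                   ≤⟨ *-monoʳ-≤ (suc (2 * y)) (exponent-bound y j) ⟩
  suc (2 * y) ^ suc (suc j)                   ∎
  where
  open ≤-Reasoning
  p = y ^ suc j
  expand : ∀ y p → suc (2 * (y * p)) + (2 * (y * p) + 2 * y + 2 * p) ≡ suc (2 * y) * suc (2 * p)
  expand = solve-∀

theorem1p2 : (r d : ℕ) → 2 ≤ r → 1 ≤ d →
    Σ ℕ λ p → Σ ℕ λ q → 1 ≤ q × q ≤ p * (5 * r * d) ^ (r ∸ 1) ×
    ((m : ℕ) (H : PartiteGraph r m) → TraceBounded d H →
    Σ ℕ λ n₀ → (n : ℕ) → n₀ ≤ n → (G : RGraph r n) →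
    n ^ (r * q) ≤ numEdges G ^ q * n ^ p → ContainsCopy G H)
theorem1p2 r@(suc (suc j)) d@(suc _) _ 1≤d =
  -- The exponent `p / q` is exactly `(5rd) ^ (1 - r)`, so the required lower bound holds with
  -- equality.
  1 , q , m^n>0 (5 * r * d) (suc j) , ≤-reflexive (sym (*-identityˡ q)) , embed
  where
  open ≤-Reasoning
  q = (5 * r * d) ^ suc j
  -- `suc t` is `r * d`, the number of random vertices, so `suc (suc t)` is `r * d + 1`; `K` is the
  -- exponent in `dense⇒embeds` for `r` classes.
  t = r * d ∸ 1
  K = 2 * suc (suc t) ^ suc j

  instance
    q≢0 : NonZero q
    q≢0 = m^n≢0 (5 * r * d) (suc j)

  K<q : suc K ≤ q
  K<q = ≤-trans (exponent-bound (suc (suc t)) j) (^-monoˡ-≤ (suc j) (begin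
    suc (2 * suc (suc t))          ≤⟨ m≤m+n _ (3 * t) ⟩
    suc (2 * suc (suc t)) + 3 * t  ≡⟨ collect t ⟩
    5 * suc t                      ≡⟨ *-assoc 5 r d ⟨
    5 * r * d                      ∎))
    where
    collect : ∀ t → suc (2 * suc (suc t)) + 3 * t ≡ 5 * suc t
    collect = solve-∀

  embed : (m : ℕ) (H : PartiteGraph r m) → TraceBounded d H →
    Σ ℕ λ n₀ → (n : ℕ) → n₀ ≤ n → (G : RGraph r n) →
    n ^ (r * q) ≤ numEdges G ^ q * n ^ 1 → ContainsCopy G H
  -- `vertexIn` requires a vertex to fall back on, so the empty `H` is treated apart. An edge would
  -- contain a vertex of the lowest class, so there are none.
  embed zero H _ = 0 , λ n _ G _ → (λ ()) , (λ { {()} }) ,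
    All.map (λ tr → contradiction (proj₁ (tr zero)) λ ()) (transversal H)
  embed m@(suc _) H bounded = C ^ q , copy
    where
    -- The threshold `C ^ q` forces `C ≤ l`. One factor `l`, spare because `K < q`, then beats
    -- `m ^ suc t` and the `2 ^ K` lost in replacing `suc l` by `2 * l`.
    C = suc (2 ^ K * m ^ suc t)
    copy : (n : ℕ) → C ^ q ≤ n → (G : RGraph r n) → n ^ (r * q) ≤ numEdges G ^ q * n ^ 1 → ContainsCopy G H
    copy n C^q≤n G many with floor-root q n
    ... | l , l^q≤n , n<sl^q =
      embeds⇒containsCopy H G 1≤d bounded
        (dense⇒embeds (layered H 1≤d bounded) t (suc j) (suc l) (isEdgeTuple G) ≤-refl 1≤d ≤-refl
          (s≤s 1≤l) dense small)
      where
      C≤l : C ≤ l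
      C≤l = ≮⇒≥ λ l<C → <-irrefl refl (<-≤-trans n<sl^q (≤-trans (^-monoˡ-≤ q l<C) C^q≤n))
      1≤l : 1 ≤ l
      1≤l = ≤-trans (s≤s z≤n) C≤l
      instance
        l≢0 : NonZero l
        l≢0 = >-nonZero 1≤l
      e = numEdges G
      dense : n ^ r ≤ ∑ (tuples r (allFin n)) (λ x → ⟦ isEdgeTuple G x ⟧) * suc l
      -- The two sides are compared after raising to the power `q`: `many` bounds `n ^ (r * q)` by
      -- `e ^ q * n`, and `n` is below `suc l ^ q`.
      dense = ≤-trans (≮⇒≥ λ lt → <-irrefl refl (begin-strict
        (e * suc l) ^ q    <⟨ ^-monoˡ-< q lt ⟩
        (n ^ r) ^ q        ≡⟨ ^-*-assoc n r q ⟩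
        n ^ (r * q)        ≤⟨ many ⟩
        e ^ q * n ^ 1      ≡⟨ cong (e ^ q *_) (*-identityʳ n) ⟩
        e ^ q * n          ≤⟨ *-monoʳ-≤ (e ^ q) (<⇒≤ n<sl^q) ⟩
        e ^ q * suc l ^ q  ≡⟨ ^-distribʳ-* q e (suc l) ⟨
        (e * suc l) ^ q    ∎)) (*-monoˡ-≤ (suc l) (numEdges≤#edgeTuples G))
      small : suc l ^ K * m ^ suc t < n
      small = begin-strict
        suc l ^ K * m ^ suc t          ≤⟨ *-monoˡ-≤ (m ^ suc t) (^-monoˡ-≤ K 1+l≤2*l) ⟩
        (2 * l) ^ K * m ^ suc t        ≡⟨ cong (_* m ^ suc t) (^-distribʳ-* K 2 l) ⟩
        2 ^ K * l ^ K * m ^ suc t      ≡⟨ shuffle (2 ^ K) (l ^ K) (m ^ suc t) ⟩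
        2 ^ K * m ^ suc t * l ^ K      <⟨ *-monoˡ-< (l ^ K) {{m^n≢0 l K}} C≤l ⟩
        l ^ suc K                      ≤⟨ ^-monoʳ-≤ l K<q ⟩
        l ^ q                          ≤⟨ l^q≤n ⟩
        n                              ∎
        where
        shuffle : ∀ x y z → x * y * z ≡ x * z * y
        shuffle = solve-∀
        1+l≤2*l : suc l ≤ 2 * l
        1+l≤2*l = ≤-trans (+-monoˡ-≤ l 1≤l) (≤-reflexive (double l))
          where
          double : ∀ l → l + l ≡ 2 * l
          double = solve-∀
theorem1p2 (suc (suc _)) zero _ ()
theorem1p2 (suc zero) _ (s≤s ())
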